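{- Let $U=\{1,\dots,n\}$ with metric $d$, and assume $p_i=p\in[0,1]$ for all $i\in U$. Then the distance-greedy algorithm provides a $\frac12$-approximation guarantee for MaxSSD. That is, for any ordering $S$ of $U$ output by the algorithm, $$\mathcal{S}_+(S)\ \ge\ \tfrac12\max_{O}\mathcal{S}_+(O),$$ the maximum being over all orderings $O$ of $U$.
   Context: For an ordering $O=(\pi(1),\dots,\pi(n))$ of $U$ let $O_k=(\pi(1),\dots,\pi(k))$. A user examines items in order; on examining $\pi(i)$ the user, independently with probability $p_{\pi(i)}$, accepts it and continues, and otherwise quits without accepting it. Let $A$ be the random prefix of accepted items: $\Pr(A=O_k)=\prod_{i=1}^kp_{\pi(i)}(1-p_{\pi(k+1)})$ for $0\le k\le n-1$ and $\Pr(A=O_n)=\prod_{i=1}^np_{\pi(i)}$. For a set (or sequence) $S$ of items let $\mathrm{Div}(S)=\sum_{\{i,j\}\subseteq S,\,i\neq j}d(i,j)$, each unordered pair being counted once. The sequential sum diversity is $\mathcal{S}_+(O)=\mathbb{E}_A[\mathrm{Div}(A)]$; MaxSSD asks for an ordering of $U$ maximizing $\mathcal{S}_+$. Distance-greedy algorithm: start with the empty sequence $S$; while $|S|<n$, append to $S$ an item $u\in U\setminus S$ maximizing $\mathrm{Div}(S\cup\{u\})$ (ties broken arbitrarily). Output the resulting ordering $S$. -}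

module Defs where

open import Level using (Level; suc; _⊔_)
open import Algebra.Bundles using (CommutativeRing)
open import Algebra.Core using (Op₁; Op₂)
open import Algebra.Structures using (IsCommutativeRing)
import Algebra.Definitions.RawMonoid as RawMonoidOps
import Algebra.Properties.Ring as RingProperties
open import Data.Fin.Base using (Fin; toℕ)
open import Data.Fin.Permutation using (Permutation′; _⟨$⟩ʳ_)
open import Data.List.Base using (List; []; _∷_; _∷ʳ_; foldr; take; drop; tabulate)
open import Data.List.Membership.Propositional using (_∉_)
open import Data.Nat.Base as ℕ using (ℕ)
open import Data.Product.Base using (∃; _×_; _,_; proj₁)
open import Data.Sum.Base using (inj₁; inj₂)
open import Function.Metric.Structures using (IsGeneralMetric)
open import Relation.Binary.Core using (Rel)
open import Relation.Binary.PropositionalEquality.Core using (_≡_)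
open import Relation.Binary.Structures using (IsTotalOrder)
open import Relation.Nullary.Negation.Core using (¬_)

-- The real numbers enter only through the axioms of an ordered field.
record OrderedField c ℓ₁ ℓ₂ : Set (suc (c ⊔ ℓ₁ ⊔ ℓ₂)) where
  infix  4 _≈_ _≤_
  infixl 6 _+_
  infixl 7 _*_
  infix  8 -_
  field
    Carrier           : Set c
    _≈_               : Rel Carrier ℓ₁
    _≤_               : Rel Carrier ℓ₂
    _+_ _*_           : Op₂ Carrier
    -_                : Op₁ Carrier
    0# 1#             : Carrier
    isCommutativeRing : IsCommutativeRing _≈_ _+_ _*_ -_ 0# 1#
    isTotalOrder      : IsTotalOrder _≈_ _≤_
    +-monoʳ-≤         : ∀ z {x y} → x ≤ y → z + x ≤ z + y
    *-nonNeg          : ∀ {x y} → 0# ≤ x → 0# ≤ y → 0# ≤ x * y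
    1≉0               : ¬ (1# ≈ 0#)
    inverse           : ∀ x → ¬ (x ≈ 0#) → ∃ λ y → x * y ≈ 1#

  commutativeRing : CommutativeRing c ℓ₁
  commutativeRing = record { isCommutativeRing = isCommutativeRing }

  open CommutativeRing commutativeRing public
    hiding (Carrier; _≈_; _+_; _*_; -_; 0#; 1#; isCommutativeRing)
  open IsTotalOrder isTotalOrder public
    using (total; antisym; ≤-respˡ-≈; ≤-respʳ-≈)
    renaming (refl to ≤-refl; reflexive to ≤-reflexive; trans to ≤-trans)

  private
    open RingProperties ring using (-1*x≈-x; -‿involutive)

    0≤1 : 0# ≤ 1#
    0≤1 with total 0# 1#
    ... | inj₁ 0≤1 = 0≤1
    ... | inj₂ 1≤0 = ≤-respʳ-≈ (trans (-1*x≈-x (- 1#)) (-‿involutive 1#)) (*-nonNeg 0≤-1 0≤-1)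
      where
      0≤-1 : 0# ≤ - 1#
      0≤-1 = ≤-respˡ-≈ (-‿inverseˡ 1#) (≤-respʳ-≈ (+-identityʳ (- 1#)) (+-monoʳ-≤ (- 1#) 1≤0))

  1+1≉0 : ¬ (1# + 1# ≈ 0#)
  1+1≉0 2≈0 = 1≉0 (antisym 1≤0 0≤1)
    where
    1≤0 : 1# ≤ 0#
    1≤0 = ≤-respʳ-≈ 2≈0 (≤-respˡ-≈ (+-identityʳ 1#) (+-monoʳ-≤ 1# 0≤1))

  ½ : Carrier
  ½ = proj₁ (inverse (1# + 1#) 1+1≉0)

-- The set of items U is Fin n; `π ⟨$⟩ʳ i` is the item in position i.
Ordering : ℕ → Set
Ordering = Permutation′

sequence : ∀ {n} → Ordering n → List (Fin n)
sequence π = tabulate (π ⟨$⟩ʳ_)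

module SequentialDiversity {c ℓ₁ ℓ₂} (F : OrderedField c ℓ₁ ℓ₂) where
  open OrderedField F
  open RawMonoidOps +-rawMonoid using (sum)

  IsMetric : ∀ {n} → (Fin n → Fin n → Carrier) → Set (ℓ₁ ⊔ ℓ₂ ⊔ c)
  IsMetric = IsGeneralMetric _≡_ _≈_ _≤_ 0# _+_

  module _ {n : ℕ} (d : Fin n → Fin n → Carrier) where

    -- Every pair of positions contributes once. The lists considered below
    -- have no repetitions, so this is the sum over unordered pairs of items.
    Div : List (Fin n) → Carrier
    Div []       = 0#
    Div (x ∷ xs) = foldr (λ y s → d x y + s) 0# xs + Div xs

    -- GreedyRun S: S can be the current sequence at some point of an
    -- execution of the distance-greedy algorithm.
    data GreedyRun : List (Fin n) → Set ℓ₂ where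
      start  : GreedyRun []
      append : ∀ {S u} → GreedyRun S → u ∉ S →
               (∀ v → v ∉ S → Div (S ∷ʳ v) ≤ Div (S ∷ʳ u)) →
               GreedyRun (S ∷ʳ u)

    -- `sequence O` has length n, so the execution has terminated.
    GreedyOutput : Ordering n → Set ℓ₂
    GreedyOutput O = GreedyRun (sequence O)

  module _ {n : ℕ} (p : Fin n → Carrier) where

    allAccepted : List (Fin n) → Carrier
    allAccepted = foldr (λ i q → p i * q) 1#

    -- The argument is the part of the ordering after the accepted prefix: its
    -- first item, if there is one, has to be rejected.
    stops : List (Fin n) → Carrier
    stops []      = 1#
    stops (i ∷ _) = 1# - p i

    -- Pr(A = O_k)
    prefixProbability : Ordering n → ℕ → Carrier
    prefixProbability O k =
      allAccepted (take k (sequence O)) * stops (drop k (sequence O))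

    -- 𝔼[f(A)] = Σ_{k = 0}^{n} Pr(A = O_k) f(O_k)
    expectation : Ordering n → (List (Fin n) → Carrier) → Carrier
    expectation O f =
      sum {ℕ.suc n} λ k → prefixProbability O (toℕ k) * f (take (toℕ k) (sequence O))

    S₊ : (Fin n → Fin n → Carrier) → Ordering n → Carrier
    S₊ d O = expectation O (Div d)

  IsMaximum : ∀ {n} → (Ordering n → Carrier) → Carrier → Set (ℓ₁ ⊔ ℓ₂)
  IsMaximum f m = (∃ λ O → f O ≈ m) × (∀ O → f O ≤ m)

{-# OPTIONS --safe #-}
module Submission where

-- With equal acceptance probabilities, Pr(A = O_k) does not depend on O, so it
-- suffices to compare prefixes of equal length: Div(O_q) ≤ 2 Div(S_q). For the
-- greedy prefix G of length i < q and a competitor O of length q, put A = O ∩ G,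
-- B = G ∖ A, C = O ∖ A. The triangle inequality gives
-- |Y| Div(X) ≤ (|X| − 1) d(X, Y) for all X, Y; combining it for (C, A), (C, B)
-- and (A, C) yields i |C| Div(O) ≤ q (q − 1) d(C, G). As the greedy increment
-- dominates the average of d(v, G) over v ∈ C, it is at least
-- i Div(O) / (q (q − 1)), and summing over i < q gives Div(O) / 2.

open import Defs
open import Data.Nat.Base using (ℕ)
open import Data.Fin.Base using (Fin)
open import Data.Product.Base using (∃; _×_)
open import Algebra.Bundles using (CommutativeMonoid)
import Algebra.Properties.CommutativeSemigroup as CommutativeSemigroupProperties
import Algebra.Properties.CommutativeMonoid.Sum as CommutativeMonoidSum
import Algebra.Properties.Monoid.Sum as MonoidSum
import Algebra.Properties.Ring as RingProperties
import Algebra.Properties.Semiring.Mult as SemiringMult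
import Algebra.Solver.Ring.NaturalCoefficients.Default as NaturalCoefficients
open import Data.Fin.Base using (zero; suc; toℕ; punchIn)
open import Data.Fin.Permutation as Perm using (_⟨$⟩ʳ_; insert; remove; insert-remove)
open import Data.Fin.Properties using (_≟_)
open import Data.List.Base
  using (List; []; _∷_; _∷ʳ_; _++_; foldr; length; take; drop; allFin)
import Data.List.Extrema as Extrema
open import Data.List.Membership.DecPropositional using (_∈?_)
open import Data.List.Membership.Propositional using (_∉_)
open import Data.List.Membership.Propositional.Properties
  using (∈-∃++; ∈-++⁺ˡ; ∈-++⁻; ∈-allFin)
open import Data.List.Properties using (length-++; length-++-comm; length-take; length-drop; length-tabulate; tabulate-cong)
open import Data.List.Relation.Binary.Permutation.Propositional as ↭ using (_↭_; ↭-sym)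
open import Data.List.Relation.Binary.Permutation.Propositional.Properties
  using (∈-resp-↭; ↭-length; shift; ∷↭∷ʳ; ++⁺ˡ)
open import Data.List.Relation.Unary.All as All using (All; []; _∷_)
open import Data.List.Relation.Unary.All.Properties using (All¬⇒¬Any)
open import Data.List.Relation.Unary.Unique.Propositional using (Unique; []; _∷_)
import Data.List.Relation.Unary.Unique.Propositional.Properties as Unique
import Data.Nat.Base as ℕ
import Data.Nat.Properties as ℕ
open import Data.Product.Base using (∃₂; _,_; proj₁; proj₂)
open import Data.Sum.Base using (_⊎_; inj₁; inj₂)
open import Function.Base using (_∘_)
import Function.Bundles as Func
import Function.Properties.Inverse as Inverse
open import Function.Metric.Structures using (module IsGeneralMetric)
open import Relation.Binary.Bundles using (TotalOrder)
open import Relation.Binary.PropositionalEquality.Core as ≡ using (_≡_)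
import Relation.Binary.Reasoning.PartialOrder as PartialOrderReasoning
open import Relation.Nullary.Decidable.Core using (yes; no)
open import Relation.Nullary.Negation.Core using (contradiction)

-- Splitting two lists along their common items.

-- Produces the sets A, B, C of the overview when `X` is O and `Y` is G. An item of `X` that occurs
-- in `Y` is moved from `B` to `A`; as `X` has no repetitions, it cannot have been put into `A`
-- before.
split-∩ : ∀ {n} (X Y : List (Fin n)) → Unique X →
          ∃ λ A → ∃₂ λ B C → X ↭ A ++ C × Y ↭ A ++ B × All (_∉ Y) C
split-∩ []      Y []           = [] , Y , [] , ↭.refl , ↭.refl , []
split-∩ (x ∷ X) Y (x∉X ∷ X!) with split-∩ X Y X! | _∈?_ _≟_ x Y
... | A , B , C , X↭ , Y↭ , C#Y | no x∉Y =
  A , B , x ∷ C , ↭.trans (↭.prep x X↭) (↭-sym (shift x A C)) , Y↭ , x∉Y ∷ C#Y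
... | A , B , C , X↭ , Y↭ , C#Y | yes x∈Y with ∈-++⁻ A (∈-resp-↭ Y↭ x∈Y)
...   | inj₁ x∈A = contradiction (∈-resp-↭ (↭-sym X↭) (∈-++⁺ˡ x∈A)) (All¬⇒¬Any x∉X)
...   | inj₂ x∈B with ∈-∃++ x∈B
...     | B₁ , B₂ , ≡.refl =
  x ∷ A , B₁ ++ B₂ , C , ↭.prep x X↭ ,
  ↭.trans Y↭ (↭.trans (++⁺ˡ A (shift x B₁ B₂)) (shift x A (B₁ ++ B₂))) , C#Y

-- Inequalities in an ordered field.

module OrderedFieldProperties {c ℓ₁ ℓ₂} (F : OrderedField c ℓ₁ ℓ₂) where
  open OrderedField F hiding (zero)

  totalOrder : TotalOrder c ℓ₁ ℓ₂
  totalOrder = record { isTotalOrder = isTotalOrder }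

  open PartialOrderReasoning (TotalOrder.poset totalOrder)
  open NaturalCoefficients commutativeSemiring using (solve; _:=_; _:+_; _:*_; con)
  open CommutativeSemigroupProperties
    (CommutativeMonoid.commutativeSemigroup +-commutativeMonoid) using (interchange; x∙yz≈y∙xz)
  open RingProperties ring using (-1*x≈-x; -‿involutive)
  open SemiringMult semiring using () renaming (_×_ to _×ₙ_; ×-homo-+ to ×ₙ-homo-+)
  open MonoidSum +-monoid using (sum)

  +-mono-≤ : ∀ {x y u v} → x ≤ y → u ≤ v → x + u ≤ y + v
  +-mono-≤ {x} {y} {u} {v} x≤y u≤v = begin
    x + u  ≤⟨ +-monoʳ-≤ x u≤v ⟩
    x + v  ≈⟨ +-comm x v ⟩
    v + x  ≤⟨ +-monoʳ-≤ v x≤y ⟩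
    v + y  ≈⟨ +-comm v y ⟩
    y + v  ∎

  +-nonNeg : ∀ {x y} → 0# ≤ x → 0# ≤ y → 0# ≤ x + y
  +-nonNeg 0≤x 0≤y = ≤-respˡ-≈ (+-identityˡ 0#) (+-mono-≤ 0≤x 0≤y)

  +-cancelˡ-≤ : ∀ z {x y} → z + x ≤ z + y → x ≤ y
  +-cancelˡ-≤ z {x} {y} z+x≤z+y = begin
    x              ≈⟨ cancel x ⟨
    - z + (z + x)  ≤⟨ +-monoʳ-≤ (- z) z+x≤z+y ⟩
    - z + (z + y)  ≈⟨ cancel y ⟩
    y              ∎
    where
    cancel : ∀ w → - z + (z + w) ≈ w
    cancel w = begin-equality
      - z + (z + w)  ≈⟨ +-assoc (- z) z w ⟨
      - z + z + w    ≈⟨ +-congʳ (-‿inverseˡ z) ⟩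
      0# + w         ≈⟨ +-identityˡ w ⟩
      w              ∎

  x≤y⇒0≤y-x : ∀ {x y} → x ≤ y → 0# ≤ y - x
  x≤y⇒0≤y-x {x} {y} x≤y = begin
    0#       ≈⟨ -‿inverseˡ x ⟨
    - x + x  ≤⟨ +-monoʳ-≤ (- x) x≤y ⟩
    - x + y  ≈⟨ +-comm (- x) y ⟩
    y - x    ∎

  *-monoˡ-≤ : ∀ z {x y} → 0# ≤ z → x ≤ y → z * x ≤ z * y
  *-monoˡ-≤ z {x} {y} 0≤z x≤y = begin
    z * x                    ≈⟨ +-identityʳ (z * x) ⟨
    z * x + 0#               ≤⟨ +-monoʳ-≤ (z * x) (*-nonNeg 0≤z (x≤y⇒0≤y-x x≤y)) ⟩
    z * x + z * (y - x)      ≈⟨ distribˡ z x (y - x) ⟨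
    z * (x + (y - x))        ≈⟨ *-congˡ (+-comm x (y - x)) ⟩
    z * (y - x + x)          ≈⟨ *-congˡ (+-assoc y (- x) x) ⟩
    z * (y + (- x + x))      ≈⟨ *-congˡ (+-congˡ (-‿inverseˡ x)) ⟩
    z * (y + 0#)             ≈⟨ *-congˡ (+-identityʳ y) ⟩
    z * y                    ∎

  0≤1 : 0# ≤ 1#
  0≤1 with total 0# 1#
  ... | inj₁ 0≤1 = 0≤1
  ... | inj₂ 1≤0 = ≤-respʳ-≈ (trans (-1*x≈-x (- 1#)) (-‿involutive 1#)) (*-nonNeg 0≤-1 0≤-1)
    where
    0≤-1 : 0# ≤ - 1#
    0≤-1 = ≤-respʳ-≈ (+-identityˡ (- 1#)) (x≤y⇒0≤y-x 1≤0)

  -- Positivity of the factor is expressed by the form `1# + t`, which is the form that the length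
  -- of a nonempty list takes in the field. If `y ≤ x`, then t x + x ≤ t y + y ≤ t x + y, and t x
  -- cancels.
  *-cancelˡ-≤ : ∀ {t x y} → 0# ≤ t → (1# + t) * x ≤ (1# + t) * y → x ≤ y
  *-cancelˡ-≤ {t} {x} {y} 0≤t tx≤ty with total x y
  ... | inj₁ x≤y = x≤y
  ... | inj₂ y≤x = +-cancelˡ-≤ (t * x) (begin
    t * x + x      ≈⟨ expand x ⟨
    (1# + t) * x   ≤⟨ tx≤ty ⟩
    (1# + t) * y   ≈⟨ expand y ⟩
    t * y + y      ≤⟨ +-mono-≤ (*-monoˡ-≤ t 0≤t y≤x) ≤-refl ⟩
    t * x + y      ∎)
    where
    expand : ∀ w → (1# + t) * w ≈ t * w + w
    expand w = solve 2 (λ t w → (con 1 :+ t) :* w := t :* w :+ w) refl t w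

  ½x+½x≈x : ∀ x → ½ * x + ½ * x ≈ x
  ½x+½x≈x x = begin-equality
    ½ * x + ½ * x      ≈⟨ solve 2 (λ h x → h :* x :+ h :* x := (con 1 :+ con 1) :* h :* x) refl ½ x ⟩
    (1# + 1#) * ½ * x  ≈⟨ *-congʳ (proj₂ (inverse (1# + 1#) 1+1≉0)) ⟩
    1# * x             ≈⟨ *-identityˡ x ⟩
    x                  ∎

  x≤y+y⇒½x≤y : ∀ {x y} → x ≤ y + y → ½ * x ≤ y
  x≤y+y⇒½x≤y {x} {y} x≤y+y = *-cancelˡ-≤ 0≤1 (begin
    (1# + 1#) * (½ * x)  ≈⟨ double (½ * x) ⟩
    ½ * x + ½ * x        ≈⟨ ½x+½x≈x x ⟩
    x                    ≤⟨ x≤y+y ⟩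
    y + y                ≈⟨ double y ⟨
    (1# + 1#) * y        ∎)
    where
    double : ∀ w → (1# + 1#) * w ≈ w + w
    double w = solve 1 (λ w → (con 1 :+ con 1) :* w := w :+ w) refl w

  -- List lengths as scalars, and finite sums.

  ⟦_⟧ : ℕ → Carrier
  ⟦ n ⟧ = n ×ₙ 1#

  ⟦⟧-homo-+ : ∀ m n → ⟦ m ℕ.+ n ⟧ ≈ ⟦ m ⟧ + ⟦ n ⟧
  ⟦⟧-homo-+ = ×ₙ-homo-+ 1#

  ⟦⟧-nonNeg : ∀ n → 0# ≤ ⟦ n ⟧
  ⟦⟧-nonNeg ℕ.zero    = ≤-refl
  ⟦⟧-nonNeg (ℕ.suc n) = +-nonNeg 0≤1 (⟦⟧-nonNeg n)

  sum-mono-≤ : ∀ {n} {f g : Fin n → Carrier} → (∀ i → f i ≤ g i) → sum f ≤ sum g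
  sum-mono-≤ {ℕ.zero}  f≤g = ≤-refl
  sum-mono-≤ {ℕ.suc n} f≤g = +-mono-≤ (f≤g zero) (sum-mono-≤ (f≤g ∘ suc))

  module _ {a} {A : Set a} where

    -- The same fold as in `Div`, so that `Div d (x ∷ X)` computes to `Σ (d x) X + Div d X`.
    Σ : (A → Carrier) → List A → Carrier
    Σ f = foldr (λ y s → f y + s) 0#

    Σ-cong : ∀ {f g} → (∀ x → f x ≈ g x) → ∀ X → Σ f X ≈ Σ g X
    Σ-cong f≈g []      = refl
    Σ-cong f≈g (x ∷ X) = +-cong (f≈g x) (Σ-cong f≈g X)

    Σ-mono-≤ : ∀ {f g X} → All (λ x → f x ≤ g x) X → Σ f X ≤ Σ g X
    Σ-mono-≤ []            = ≤-refl
    Σ-mono-≤ (fx≤gx ∷ f≤g) = +-mono-≤ fx≤gx (Σ-mono-≤ f≤g)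

    Σ-nonNeg : ∀ {f} → (∀ x → 0# ≤ f x) → ∀ X → 0# ≤ Σ f X
    Σ-nonNeg 0≤f []      = ≤-refl
    Σ-nonNeg 0≤f (x ∷ X) = +-nonNeg (0≤f x) (Σ-nonNeg 0≤f X)

    Σ-const : ∀ z X → Σ (λ _ → z) X ≈ ⟦ length X ⟧ * z
    Σ-const z []      = sym (zeroˡ z)
    Σ-const z (x ∷ X) = begin-equality
      z + Σ (λ _ → z) X          ≈⟨ +-cong (sym (*-identityˡ z)) (Σ-const z X) ⟩
      1# * z + ⟦ length X ⟧ * z  ≈⟨ distribʳ z 1# ⟦ length X ⟧ ⟨
      (1# + ⟦ length X ⟧) * z    ∎

    Σ-+ : ∀ f g X → Σ (λ x → f x + g x) X ≈ Σ f X + Σ g X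
    Σ-+ f g []      = sym (+-identityˡ 0#)
    Σ-+ f g (x ∷ X) = trans (+-congˡ (Σ-+ f g X)) (interchange (f x) (g x) (Σ f X) (Σ g X))

    Σ-*ˡ : ∀ z f X → Σ (λ x → z * f x) X ≈ z * Σ f X
    Σ-*ˡ z f []      = sym (zeroʳ z)
    Σ-*ˡ z f (x ∷ X) = trans (+-congˡ (Σ-*ˡ z f X)) (sym (distribˡ z (f x) (Σ f X)))

    Σ-++ : ∀ f X Y → Σ f (X ++ Y) ≈ Σ f X + Σ f Y
    Σ-++ f []      Y = sym (+-identityˡ (Σ f Y))
    Σ-++ f (x ∷ X) Y = trans (+-congˡ (Σ-++ f X Y)) (sym (+-assoc (f x) (Σ f X) (Σ f Y)))

    Σ-↭ : ∀ f {X Y} → X ↭ Y → Σ f X ≈ Σ f Y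
    Σ-↭ f ↭.refl            = refl
    Σ-↭ f (↭.prep x X↭Y)    = +-congˡ (Σ-↭ f X↭Y)
    Σ-↭ f (↭.swap x y X↭Y)  =
      trans (x∙yz≈y∙xz (f x) (f y) _) (+-congˡ (+-congˡ (Σ-↭ f X↭Y)))
    Σ-↭ f (↭.trans X↭Y Y↭Z) = trans (Σ-↭ f X↭Y) (Σ-↭ f Y↭Z)

    Σ-comm : ∀ (f : A → A → Carrier) X Y → Σ (λ x → Σ (f x) Y) X ≈ Σ (λ y → Σ (λ x → f x y) X) Y
    Σ-comm f []      Y = sym (trans (Σ-const 0# Y) (zeroʳ ⟦ length Y ⟧))
    Σ-comm f (x ∷ X) Y = begin-equality
      Σ (f x) Y + Σ (λ x → Σ (f x) Y) X          ≈⟨ +-congˡ (Σ-comm f X Y) ⟩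
      Σ (f x) Y + Σ (λ y → Σ (λ x → f x y) X) Y  ≈⟨ Σ-+ (f x) (λ y → Σ (λ x → f x y) X) Y ⟨
      Σ (λ y → f x y + Σ (λ x → f x y) X) Y      ∎

-- Diversity and cross sums in a metric space.

module MetricDiversity {c ℓ₁ ℓ₂} (F : OrderedField c ℓ₁ ℓ₂) {n : ℕ}
  (d : Fin n → Fin n → OrderedField.Carrier F) (isMetric : SequentialDiversity.IsMetric F d)
  where

  open OrderedField F hiding (zero)
  open SequentialDiversity F
  open OrderedFieldProperties F
  open IsGeneralMetric isMetric using ()
    renaming (sym to d-sym; triangle to d-triangle; nonNegative to d-nonNeg)
  open PartialOrderReasoning (TotalOrder.poset totalOrder) hiding (start)
  open NaturalCoefficients commutativeSemiring using (solve; _:=_; _:+_; _:*_; con)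

  -- The quantity d(X, Y) of the overview.
  cross : List (Fin n) → List (Fin n) → Carrier
  cross X Y = Σ (λ x → Σ (d x) Y) X

  cross-comm : ∀ X Y → cross X Y ≈ cross Y X
  cross-comm X Y = trans (Σ-comm d X Y) (Σ-cong (λ y → Σ-cong (λ x → d-sym x y) X) Y)

  cross-++ʳ : ∀ X Y Z → cross X (Y ++ Z) ≈ cross X Y + cross X Z
  cross-++ʳ X Y Z = trans (Σ-cong (λ x → Σ-++ (d x) Y Z) X) (Σ-+ (λ x → Σ (d x) Y) (λ x → Σ (d x) Z) X)

  cross-nonNeg : ∀ X Y → 0# ≤ cross X Y
  cross-nonNeg X Y = Σ-nonNeg (λ x → Σ-nonNeg (λ y → d-nonNeg) Y) X

  Div-nonNeg : ∀ X → 0# ≤ Div d X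
  Div-nonNeg []      = ≤-refl
  Div-nonNeg (x ∷ X) = +-nonNeg (Σ-nonNeg (λ y → d-nonNeg) X) (Div-nonNeg X)

  Div-++ : ∀ X Y → Div d (X ++ Y) ≈ Div d X + Div d Y + cross X Y
  Div-++ []      Y = sym (trans (+-identityʳ _) (+-identityˡ _))
  Div-++ (x ∷ X) Y = begin-equality
    Σ (d x) (X ++ Y) + Div d (X ++ Y)
      ≈⟨ +-cong (Σ-++ (d x) X Y) (Div-++ X Y) ⟩
    (Σ (d x) X + Σ (d x) Y) + (Div d X + Div d Y + cross X Y)
      ≈⟨ solve 5 (λ s t u v w → (s :+ t) :+ (u :+ v :+ w) := (s :+ u) :+ v :+ (t :+ w)) refl
           (Σ (d x) X) (Σ (d x) Y) (Div d X) (Div d Y) (cross X Y) ⟩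
    (Σ (d x) X + Div d X) + Div d Y + (Σ (d x) Y + cross X Y)
      ∎

  -- Symmetry of `d` makes the order of the list irrelevant; this allows O to be rearranged as
  -- `A ++ C`.
  Div-↭ : ∀ {X Y} → X ↭ Y → Div d X ≈ Div d Y
  Div-↭ ↭.refl                   = refl
  Div-↭ (↭.prep x X↭Y)           = +-cong (Σ-↭ (d x) X↭Y) (Div-↭ X↭Y)
  Div-↭ (↭.swap {X} {Y} x y X↭Y) = begin-equality
    (d x y + Σ (d x) X) + (Σ (d y) X + Div d X)
      ≈⟨ solve 4 (λ s t u v → (s :+ t) :+ (u :+ v) := (s :+ u) :+ (t :+ v)) refl
           (d x y) (Σ (d x) X) (Σ (d y) X) (Div d X) ⟩
    (d x y + Σ (d y) X) + (Σ (d x) X + Div d X)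
      ≈⟨ +-cong (+-cong (d-sym x y) (Σ-↭ (d y) X↭Y)) (+-cong (Σ-↭ (d x) X↭Y) (Div-↭ X↭Y)) ⟩
    (d y x + Σ (d y) Y) + (Σ (d x) Y + Div d Y)
      ∎
  Div-↭ (↭.trans X↭Y Y↭Z)        = trans (Div-↭ X↭Y) (Div-↭ Y↭Z)

  Div-∷ʳ : ∀ X x → Div d (X ∷ʳ x) ≈ Σ (d x) X + Div d X
  Div-∷ʳ X x = sym (Div-↭ (∷↭∷ʳ x X))

  -- Consequences of the triangle inequality.

  -- Every pair in `X` is routed through the centre `y`, which uses each spoke |X| - 1 times. The
  -- spokes are added on the left to avoid the subtraction.
  Div-star : ∀ y X → Div d X + Σ (d y) X ≤ ⟦ length X ⟧ * Σ (d y) X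
  Div-star y []      = ≤-reflexive (trans (+-identityʳ 0#) (sym (zeroˡ 0#)))
  Div-star y (x ∷ X) = begin
    (Σ (d x) X + Div d X) + (r + R)
      ≤⟨ +-mono-≤ (+-mono-≤ spokes ≤-refl) ≤-refl ⟩
    ((k * r + R) + Div d X) + (r + R)
      ≈⟨ solve 4 (λ k r R D → ((k :* r :+ R) :+ D) :+ (r :+ R) := (k :* r :+ R :+ r) :+ (D :+ R)) refl
           k r R (Div d X) ⟩
    (k * r + R + r) + (Div d X + R)
      ≤⟨ +-monoʳ-≤ _ (Div-star y X) ⟩
    (k * r + R + r) + k * R
      ≈⟨ solve 3 (λ k r R → (k :* r :+ R :+ r) :+ k :* R := (con 1 :+ k) :* (r :+ R)) refl k r R ⟩
    (1# + k) * (r + R)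
      ∎
    where
    k r R : Carrier
    k = ⟦ length X ⟧
    r = d y x
    R = Σ (d y) X

    spokes : Σ (d x) X ≤ k * r + R
    spokes = begin
      Σ (d x) X                   ≤⟨ Σ-mono-≤ (All.universal (λ z → ≤-respʳ-≈ (+-congʳ (d-sym x y)) (d-triangle x y z)) X) ⟩
      Σ (λ z → r + d y z) X       ≈⟨ Σ-+ (λ _ → r) (d y) X ⟩
      Σ (λ _ → r) X + Σ (d y) X   ≈⟨ +-congʳ (Σ-const r X) ⟩
      k * r + R                   ∎

  -- `Div-star` summed over all centres `y` in `Y`.
  Div-cross : ∀ X Y → ⟦ length Y ⟧ * Div d X + cross X Y ≤ ⟦ length X ⟧ * cross X Y
  Div-cross X Y = begin
    ⟦ length Y ⟧ * Div d X + cross X Y        ≈⟨ +-cong (Σ-const (Div d X) Y) (cross-comm Y X) ⟨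
    Σ (λ _ → Div d X) Y + cross Y X           ≈⟨ Σ-+ (λ _ → Div d X) (λ y → Σ (d y) X) Y ⟨
    Σ (λ y → Div d X + Σ (d y) X) Y           ≤⟨ Σ-mono-≤ (All.universal (λ y → Div-star y X) Y) ⟩
    Σ (λ y → ⟦ length X ⟧ * Σ (d y) X) Y      ≈⟨ Σ-*ˡ ⟦ length X ⟧ (λ y → Σ (d y) X) Y ⟩
    ⟦ length X ⟧ * cross Y X                  ≈⟨ *-congˡ (cross-comm Y X) ⟩
    ⟦ length X ⟧ * cross X Y                  ∎

  -- For a nonempty list the factor |X| - 1 of the overview is itself a length, so one cross sum
  -- cancels from `Div-cross`.
  Div-cross-∷ : ∀ x X Y → ⟦ length Y ⟧ * Div d (x ∷ X) ≤ ⟦ length X ⟧ * cross (x ∷ X) Y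
  Div-cross-∷ x X Y = +-cancelˡ-≤ (cross (x ∷ X) Y) (begin
    cross (x ∷ X) Y + ⟦ length Y ⟧ * Div d (x ∷ X)  ≈⟨ +-comm _ _ ⟩
    ⟦ length Y ⟧ * Div d (x ∷ X) + cross (x ∷ X) Y  ≤⟨ Div-cross (x ∷ X) Y ⟩
    (1# + ⟦ length X ⟧) * cross (x ∷ X) Y
      ≈⟨ solve 2 (λ k s → (con 1 :+ k) :* s := s :+ k :* s) refl ⟦ length X ⟧ (cross (x ∷ X) Y) ⟩
    cross (x ∷ X) Y + ⟦ length X ⟧ * cross (x ∷ X) Y ∎)

  -- e is the number of steps left, |x ∷ C| − |B|. The weights are chosen so that the
  -- coefficient of cross (x ∷ C) A in Div-exchange adds up to that of cross (x ∷ C) B.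
  Div-new : ∀ A B x C e → ⟦ length B ⟧ + e ≈ 1# + ⟦ length C ⟧ → 0# ≤ e →
            let a = ⟦ length A ⟧; b = ⟦ length B ⟧; k = ⟦ length C ⟧ in
            (a + b) * (1# + k) * Div d (x ∷ C) ≤
              e * (a + k) * cross (x ∷ C) A + (a + (1# + k)) * (a + k) * cross (x ∷ C) B
  Div-new A B x [] e b+e≈1 0≤e = begin
    (a + b) * (1# + 0#) * (0# + 0#)
      ≈⟨ trans (*-congˡ (+-identityˡ 0#)) (zeroʳ _) ⟩
    0#
      ≤⟨ +-nonNeg (*-nonNeg (*-nonNeg 0≤e 0≤a+0) (cross-nonNeg (x ∷ []) A))
                  (*-nonNeg (*-nonNeg (+-nonNeg 0≤a (+-nonNeg 0≤1 ≤-refl)) 0≤a+0) (cross-nonNeg (x ∷ []) B)) ⟩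
    e * (a + 0#) * cross (x ∷ []) A + (a + (1# + 0#)) * (a + 0#) * cross (x ∷ []) B
      ∎
    where
    a b : Carrier
    a = ⟦ length A ⟧
    b = ⟦ length B ⟧
    0≤a : 0# ≤ a
    0≤a = ⟦⟧-nonNeg (length A)
    0≤a+0 : 0# ≤ a + 0#
    0≤a+0 = +-nonNeg 0≤a ≤-refl
  -- Both sides are multiplied by k, which can be cancelled because `C` is nonempty; in the clause
  -- above k is zero, but the diversity of a singleton vanishes.
  Div-new A B x C@(_ ∷ C′) e b+e≈1+k 0≤e = *-cancelˡ-≤ (⟦⟧-nonNeg (length C′)) (begin
    k * ((a + b) * (1# + k) * D)
      -- Enlarging k to a + k creates the factor a + k that both coefficients on the right contain.
      ≤⟨ *-monoˡ-≤′ (*-nonNeg (*-nonNeg (+-nonNeg 0≤a 0≤b) (+-nonNeg 0≤1 0≤k)) (Div-nonNeg (x ∷ C))) k≤a+k ⟩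
    (a + k) * ((a + b) * (1# + k) * D)
      ≈⟨ *-congˡ (*-congʳ (*-congˡ b+e≈1+k)) ⟨
    (a + k) * ((a + b) * (b + e) * D)
      -- The identity (a + b)(b + e) = e a + (a + b + e) b distributes the diversity over the
      -- centres in `A` and those in `B`.
      ≈⟨ solve 5 (λ a b e r D → r :* ((a :+ b) :* (b :+ e) :* D) :=
                    r :* e :* (a :* D) :+ (a :+ (b :+ e)) :* r :* (b :* D)) refl a b e (a + k) D ⟩
    (a + k) * e * (a * D) + (a + (b + e)) * (a + k) * (b * D)
      ≈⟨ +-congˡ (*-congʳ (*-congʳ (+-congˡ b+e≈1+k))) ⟩
    (a + k) * e * (a * D) + (a + (1# + k)) * (a + k) * (b * D)
      ≤⟨ +-mono-≤ (*-monoˡ-≤ _ (*-nonNeg 0≤a+k 0≤e) (Div-cross-∷ x C A))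
                  (*-monoˡ-≤ _ (*-nonNeg (+-nonNeg 0≤a (+-nonNeg 0≤1 0≤k)) 0≤a+k) (Div-cross-∷ x C B)) ⟩
    (a + k) * e * (k * CA) + (a + (1# + k)) * (a + k) * (k * CB)
      ≈⟨ solve 6 (λ r e k CA q CB → r :* e :* (k :* CA) :+ q :* r :* (k :* CB) :=
                    k :* (e :* r :* CA :+ q :* r :* CB)) refl (a + k) e k CA (a + (1# + k)) CB ⟩
    k * (e * (a + k) * CA + (a + (1# + k)) * (a + k) * CB)
      ∎)
    where
    a b k D CA CB : Carrier
    a  = ⟦ length A ⟧
    b  = ⟦ length B ⟧
    k  = ⟦ length C ⟧
    D  = Div d (x ∷ C)
    CA = cross (x ∷ C) A
    CB = cross (x ∷ C) B
    0≤a : 0# ≤ a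
    0≤a = ⟦⟧-nonNeg (length A)
    0≤b : 0# ≤ b
    0≤b = ⟦⟧-nonNeg (length B)
    0≤k : 0# ≤ k
    0≤k = ⟦⟧-nonNeg (length C)
    0≤a+k : 0# ≤ a + k
    0≤a+k = +-nonNeg 0≤a 0≤k
    k≤a+k : k ≤ a + k
    k≤a+k = ≤-respˡ-≈ (+-identityˡ k) (+-mono-≤ 0≤a ≤-refl)
    *-monoˡ-≤′ : ∀ {x y z} → 0# ≤ z → x ≤ y → x * z ≤ y * z
    *-monoˡ-≤′ {x} {y} {z} 0≤z x≤y = begin
      x * z  ≈⟨ *-comm x z ⟩
      z * x  ≤⟨ *-monoˡ-≤ z 0≤z x≤y ⟩
      z * y  ≈⟨ *-comm z y ⟩
      y * z  ∎

  -- The inequality i |C| Div(O) ≤ q (q - 1) d(C, G) of the overview, whose C is `x ∷ C` here: i = a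
  -- + b, |C| = 1 + k and q = a + 1 + k. Pairs inside `A` are routed through `x ∷ C`, and pairs
  -- inside `x ∷ C` through `A` and `B`.
  Div-exchange : ∀ A B x C e → ⟦ length B ⟧ + e ≈ 1# + ⟦ length C ⟧ → 0# ≤ e →
                 let a = ⟦ length A ⟧; b = ⟦ length B ⟧; k = ⟦ length C ⟧ in
                 (1# + k) * ((a + b) * Div d (A ++ x ∷ C)) ≤
                   (a + (1# + k)) * (a + k) * cross (x ∷ C) (A ++ B)
  Div-exchange A B x C e b+e≈1+k 0≤e = begin
    (1# + k) * ((a + b) * Div d (A ++ x ∷ C))
      ≈⟨ *-congˡ (*-congˡ (trans (Div-++ A (x ∷ C)) (+-congˡ (cross-comm A (x ∷ C))))) ⟩
    (1# + k) * ((a + b) * (DA + DC + CA))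
      -- Of the 1 + k copies of `CA`, one is set aside for `bound-A`, whose left side contains it.
      ≈⟨ solve 6 (λ k a b DA DC CA → (con 1 :+ k) :* ((a :+ b) :* (DA :+ DC :+ CA)) :=
                    (a :+ b) :* ((con 1 :+ k) :* DA :+ CA) :+ (a :+ b) :* (k :* CA) :+ (a :+ b) :* (con 1 :+ k) :* DC)
           refl k a b DA DC CA ⟩
    (a + b) * ((1# + k) * DA + CA) + (a + b) * (k * CA) + (a + b) * (1# + k) * DC
      ≤⟨ +-mono-≤ (+-mono-≤ (*-monoˡ-≤ _ 0≤a+b bound-A) ≤-refl) (Div-new A B x C e b+e≈1+k 0≤e) ⟩
    (a + b) * (a * CA) + (a + b) * (k * CA) + (e * (a + k) * CA + (a + (1# + k)) * (a + k) * CB)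
      ≈⟨ solve 7 (λ a b e k CA q CB →
                    (a :+ b) :* (a :* CA) :+ (a :+ b) :* (k :* CA) :+ (e :* (a :+ k) :* CA :+ q :* (a :+ k) :* CB) :=
                    (a :+ (b :+ e)) :* (a :+ k) :* CA :+ q :* (a :+ k) :* CB)
           refl a b e k CA (a + (1# + k)) CB ⟩
    (a + (b + e)) * (a + k) * CA + (a + (1# + k)) * (a + k) * CB
      ≈⟨ +-congʳ (*-congʳ (*-congʳ (+-congˡ b+e≈1+k))) ⟩
    (a + (1# + k)) * (a + k) * CA + (a + (1# + k)) * (a + k) * CB
      ≈⟨ distribˡ _ CA CB ⟨
    (a + (1# + k)) * (a + k) * (CA + CB)
      ≈⟨ *-congˡ (cross-++ʳ (x ∷ C) A B) ⟨
    (a + (1# + k)) * (a + k) * cross (x ∷ C) (A ++ B)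
      ∎
    where
    a b k DA DC CA CB : Carrier
    a  = ⟦ length A ⟧
    b  = ⟦ length B ⟧
    k  = ⟦ length C ⟧
    DA = Div d A
    DC = Div d (x ∷ C)
    CA = cross (x ∷ C) A
    CB = cross (x ∷ C) B
    0≤a+b : 0# ≤ a + b
    0≤a+b = +-nonNeg (⟦⟧-nonNeg (length A)) (⟦⟧-nonNeg (length B))
    bound-A : (1# + k) * DA + CA ≤ a * CA
    bound-A = begin
      (1# + k) * DA + CA               ≈⟨ +-congˡ (cross-comm A (x ∷ C)) ⟨
      (1# + k) * DA + cross A (x ∷ C)  ≤⟨ Div-cross A (x ∷ C) ⟩
      a * cross A (x ∷ C)              ≈⟨ *-congˡ (cross-comm A (x ∷ C)) ⟩
      a * CA                           ∎

  -- Greedy increments and their sum.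

  -- Here `suc q` is the q of the overview. The items of C lie outside `G`, so d(C, G) is at most
  -- |C| m; inserting this into `Div-exchange` lets |C| cancel.
  marginal-bound : ∀ {G O q m} → Unique O → length O ≡ ℕ.suc q → length G ℕ.≤ q →
                   (∀ v → v ∉ G → Σ (d v) G ≤ m) →
                   ⟦ length G ⟧ * Div d O ≤ ⟦ ℕ.suc q ⟧ * ⟦ q ⟧ * m
  marginal-bound {G} {O} {q} {m} O! |O|≡1+q |G|≤q max with split-∩ O G O!
  ... | A , B , C , O↭A++C , G↭A++B , C#G = bound C O↭A++C C#G |A|+|C|≡1+q |B|<|C|
    where
    a b : Carrier
    a = ⟦ length A ⟧
    b = ⟦ length B ⟧

    |A|+|B|≤q : length A ℕ.+ length B ℕ.≤ q
    |A|+|B|≤q = ≡.subst (ℕ._≤ q) (≡.trans (↭-length G↭A++B) (length-++ A)) |G|≤q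

    |A|+|C|≡1+q : length A ℕ.+ length C ≡ ℕ.suc q
    |A|+|C|≡1+q = ≡.trans (≡.sym (≡.trans (↭-length O↭A++C) (length-++ A))) |O|≡1+q

    -- `G` is shorter than `O`, so C is nonempty, which is why `bound` has no clause for `[]`; the
    -- truncated subtraction defining `e` is exact for the same reason.
    |B|<|C| : length B ℕ.< length C
    |B|<|C| = ℕ.+-cancelˡ-< (length A) _ _
      (≡.subst (length A ℕ.+ length B ℕ.<_) (≡.sym |A|+|C|≡1+q) (ℕ.s≤s |A|+|B|≤q))

    bound : ∀ C → O ↭ A ++ C → All (_∉ G) C → length A ℕ.+ length C ≡ ℕ.suc q →
            length B ℕ.< length C → ⟦ length G ⟧ * Div d O ≤ ⟦ ℕ.suc q ⟧ * ⟦ q ⟧ * m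
    bound (x ∷ C) O↭A++C C#G |A|+|C|≡1+q |B|<|C| = *-cancelˡ-≤ (⟦⟧-nonNeg (length C)) (begin
      (1# + k) * (⟦ length G ⟧ * Div d O)
        ≈⟨ *-congˡ (*-cong |G|≈a+b (Div-↭ O↭A++C)) ⟩
      (1# + k) * ((a + b) * Div d (A ++ x ∷ C))
        ≤⟨ Div-exchange A B x C ⟦ e ⟧ b+e≈1+k (⟦⟧-nonNeg e) ⟩
      (a + (1# + k)) * (a + k) * cross (x ∷ C) (A ++ B)
        ≈⟨ *-cong (*-cong a+1+k≈1+q a+k≈q) (Σ-cong (λ y → Σ-↭ (d y) (↭-sym G↭A++B)) (x ∷ C)) ⟩
      ⟦ ℕ.suc q ⟧ * ⟦ q ⟧ * cross (x ∷ C) G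
        ≤⟨ *-monoˡ-≤ _ (*-nonNeg (⟦⟧-nonNeg (ℕ.suc q)) (⟦⟧-nonNeg q)) (Σ-mono-≤ (All.map (max _) C#G)) ⟩
      ⟦ ℕ.suc q ⟧ * ⟦ q ⟧ * Σ (λ _ → m) (x ∷ C)
        ≈⟨ *-congˡ (Σ-const m (x ∷ C)) ⟩
      ⟦ ℕ.suc q ⟧ * ⟦ q ⟧ * ((1# + k) * m)
        ≈⟨ solve 4 (λ q r c m → q :* r :* (c :* m) := c :* (q :* r :* m)) refl ⟦ ℕ.suc q ⟧ ⟦ q ⟧ (1# + k) m ⟩
      (1# + k) * (⟦ ℕ.suc q ⟧ * ⟦ q ⟧ * m)
        ∎)
      where
      e : ℕ
      e = length (x ∷ C) ℕ.∸ length B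
      k : Carrier
      k = ⟦ length C ⟧
      |G|≈a+b : ⟦ length G ⟧ ≈ a + b
      |G|≈a+b = trans (reflexive (≡.cong ⟦_⟧ (≡.trans (↭-length G↭A++B) (length-++ A))))
                      (⟦⟧-homo-+ (length A) (length B))
      b+e≈1+k : b + ⟦ e ⟧ ≈ 1# + k
      b+e≈1+k = trans (sym (⟦⟧-homo-+ (length B) e)) (reflexive (≡.cong ⟦_⟧ (ℕ.m+[n∸m]≡n (ℕ.<⇒≤ |B|<|C|))))
      a+1+k≈1+q : a + (1# + k) ≈ ⟦ ℕ.suc q ⟧
      a+1+k≈1+q = trans (sym (⟦⟧-homo-+ (length A) (length (x ∷ C)))) (reflexive (≡.cong ⟦_⟧ |A|+|C|≡1+q))
      a+k≈q : a + k ≈ ⟦ q ⟧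
      a+k≈q = trans (sym (⟦⟧-homo-+ (length A) (length C)))
        (reflexive (≡.cong ⟦_⟧ (ℕ.suc-injective (≡.trans (≡.sym (ℕ.+-suc (length A) (length C))) |A|+|C|≡1+q))))

  -- marginal-bound summed over the run, with subtraction avoided:
  -- i (i − 1) Div O ≤ 2 q (q + 1) Div G with i = length G.
  greedy-partial : ∀ {G O q} → GreedyRun d G → Unique O → length O ≡ ℕ.suc q → length G ℕ.≤ ℕ.suc q →
                   ⟦ length G ⟧ * (⟦ length G ⟧ * Div d O) ≤
                     ⟦ length G ⟧ * Div d O + ⟦ ℕ.suc q ⟧ * ⟦ q ⟧ * (Div d G + Div d G)
  greedy-partial {O = O} {q} start _ _ _ =
    ≤-reflexive (solve 3 (λ z w D → con 0 :* (con 0 :* D) := con 0 :* D :+ z :* w :* (con 0 :+ con 0)) refl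
      ⟦ ℕ.suc q ⟧ ⟦ q ⟧ (Div d O))
  greedy-partial {O = O} {q} (append {S} {u} run u∉S best) O! |O|≡1+q |S∷ʳu|≤1+q = begin
    ⟦ length (S ∷ʳ u) ⟧ * (⟦ length (S ∷ʳ u) ⟧ * D)
      ≈⟨ *-cong |S∷ʳu|≈1+i (*-congʳ |S∷ʳu|≈1+i) ⟩
    (1# + i) * ((1# + i) * D)
      -- From i to i + 1 the square gains 2 i D + D. Two copies of `step` pay for 2 i D, and the
      -- last D turns i D into (1 + i) D.
      ≈⟨ solve 2 (λ i D → (con 1 :+ i) :* ((con 1 :+ i) :* D) := i :* (i :* D) :+ (i :* D :+ i :* D) :+ D) refl i D ⟩
    i * (i * D) + (i * D + i * D) + D
      ≤⟨ +-mono-≤ (+-mono-≤ (greedy-partial run O! |O|≡1+q (ℕ.m≤n⇒m≤1+n |S|≤q)) (+-mono-≤ step step)) ≤-refl ⟩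
    i * D + Q * (Div d S + Div d S) + (Q * m + Q * m) + D
      ≈⟨ solve 5 (λ i D Q G m → i :* D :+ Q :* (G :+ G) :+ (Q :* m :+ Q :* m) :+ D :=
                    (con 1 :+ i) :* D :+ Q :* ((m :+ G) :+ (m :+ G))) refl i D Q (Div d S) m ⟩
    (1# + i) * D + Q * ((m + Div d S) + (m + Div d S))
      ≈⟨ +-cong (*-congʳ |S∷ʳu|≈1+i) (*-congˡ (+-cong (Div-∷ʳ S u) (Div-∷ʳ S u))) ⟨
    ⟦ length (S ∷ʳ u) ⟧ * D + Q * (Div d (S ∷ʳ u) + Div d (S ∷ʳ u))
      ∎
    where
    i D Q m : Carrier
    i = ⟦ length S ⟧
    D = Div d O
    Q = ⟦ ℕ.suc q ⟧ * ⟦ q ⟧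
    m = Σ (d u) S

    |S∷ʳu|≡1+|S| : length (S ∷ʳ u) ≡ ℕ.suc (length S)
    |S∷ʳu|≡1+|S| = length-++-comm S (u ∷ [])

    |S∷ʳu|≈1+i : ⟦ length (S ∷ʳ u) ⟧ ≈ 1# + i
    |S∷ʳu|≈1+i = reflexive (≡.cong ⟦_⟧ |S∷ʳu|≡1+|S|)

    |S|≤q : length S ℕ.≤ q
    |S|≤q = ℕ.s≤s⁻¹ (≡.subst (ℕ._≤ ℕ.suc q) |S∷ʳu|≡1+|S| |S∷ʳu|≤1+q)

    step : i * D ≤ Q * m
    step = marginal-bound O! |O|≡1+q |S|≤q λ v v∉S → +-cancelˡ-≤ (Div d S) (begin
      Div d S + Σ (d v) S  ≈⟨ +-comm _ _ ⟩
      Σ (d v) S + Div d S  ≈⟨ Div-∷ʳ S v ⟨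
      Div d (S ∷ʳ v)       ≤⟨ best v v∉S ⟩
      Div d (S ∷ʳ u)       ≈⟨ Div-∷ʳ S u ⟩
      m + Div d S          ≈⟨ +-comm _ _ ⟩
      Div d S + m          ∎)

  -- `greedy-partial` at the end of the run, where |G| = |O|: first |O| cancels, then one `Div d O`,
  -- then |O| - 1. The last factor is positive only for at least two items; shorter lists have
  -- diversity zero.
  greedy-bound : ∀ {G O} → GreedyRun d G → Unique O → length O ≡ length G → Div d O ≤ Div d G + Div d G
  greedy-bound {G} {[]}     run O! |O|≡|G| = +-nonNeg (Div-nonNeg G) (Div-nonNeg G)
  greedy-bound {G} {x ∷ []} run O! |O|≡|G| =
    ≤-respˡ-≈ (sym (+-identityˡ 0#)) (+-nonNeg (Div-nonNeg G) (Div-nonNeg G))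
  greedy-bound {G} {O@(_ ∷ O′@(_ ∷ O″))} run O! |O|≡|G| =
    *-cancelˡ-≤ (⟦⟧-nonNeg (length O″)) (+-cancelˡ-≤ D (*-cancelˡ-≤ (⟦⟧-nonNeg (length O′)) (begin
      ⟦ length O ⟧ * (D + r * D)
        ≈⟨ *-congˡ (solve 2 (λ r D → D :+ r :* D := (con 1 :+ r) :* D) refl r D) ⟩
      ⟦ length O ⟧ * (⟦ length O ⟧ * D)
        ≤⟨ ≡.subst (λ i → ⟦ i ⟧ * (⟦ i ⟧ * D) ≤ ⟦ i ⟧ * D + ⟦ length O ⟧ * r * (Div d G + Div d G))
             (≡.sym |O|≡|G|) (greedy-partial run O! ≡.refl (ℕ.≤-reflexive (≡.sym |O|≡|G|))) ⟩
      ⟦ length O ⟧ * D + ⟦ length O ⟧ * r * (Div d G + Div d G)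
        ≈⟨ +-congˡ (*-assoc _ _ _) ⟩
      ⟦ length O ⟧ * D + ⟦ length O ⟧ * (r * (Div d G + Div d G))
        ≈⟨ distribˡ _ _ _ ⟨
      ⟦ length O ⟧ * (D + r * (Div d G + Div d G))
        ∎)))
    where
    D r : Carrier
    D = Div d O
    r = ⟦ length O′ ⟧

  -- Prefixes of greedy runs.

  take-∷ʳ : ∀ k (S : List (Fin n)) u → (take k (S ∷ʳ u) ≡ take k S) ⊎ (take k (S ∷ʳ u) ≡ S ∷ʳ u)
  take-∷ʳ ℕ.zero            S       u = inj₁ ≡.refl
  take-∷ʳ (ℕ.suc ℕ.zero)    []      u = inj₂ ≡.refl
  take-∷ʳ (ℕ.suc (ℕ.suc k)) []      u = inj₂ ≡.refl
  take-∷ʳ (ℕ.suc k)         (x ∷ S) u with take-∷ʳ k S u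
  ... | inj₁ eq = inj₁ (≡.cong (x ∷_) eq)
  ... | inj₂ eq = inj₂ (≡.cong (x ∷_) eq)

  -- Makes `greedy-bound` available at every prefix length. Runs grow at the right end, so a prefix
  -- is either the whole run or a prefix of the run one step earlier.
  greedy-prefix : ∀ {S} k → GreedyRun d S → GreedyRun d (take k S)
  greedy-prefix ℕ.zero    start = start
  greedy-prefix (ℕ.suc k) start = start
  greedy-prefix k run@(append {S} {u} run′ _ _) with take-∷ʳ k S u
  ... | inj₁ eq = ≡.subst (GreedyRun d) (≡.sym eq) (greedy-prefix k run′)
  ... | inj₂ eq = ≡.subst (GreedyRun d) (≡.sym eq) run

-- Existence of an optimal ordering.

module OptimalOrdering {c ℓ₁ ℓ₂} (F : OrderedField c ℓ₁ ℓ₂) where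
  open OrderedField F hiding (zero)
  open SequentialDiversity F
  open OrderedFieldProperties F using (totalOrder)
  open CommutativeMonoidSum +-commutativeMonoid using (sum)
  open PartialOrderReasoning (TotalOrder.poset totalOrder)

  -- For each first item `j` the rest is optimized by induction, and then the best `j` is chosen.
  -- `f` has to respect pointwise equality because removing the first item and inserting it again
  -- restores an ordering only pointwise.
  maximizer : ∀ n (f : Ordering n → Carrier) → (∀ O O′ → O Perm.≈ O′ → f O ≈ f O′) →
              ∃ λ O → ∀ O′ → f O′ ≤ f O
  maximizer ℕ.zero    f f-cong = Perm.id , λ O → ≤-reflexive (f-cong O Perm.id λ ())
  maximizer (ℕ.suc n) f f-cong = candidate j₀ , bound
    where
    open Extrema totalOrder using (argmax; f[xs]≤f[argmax])

    best : ∀ j → ∃ λ O → ∀ O′ → f (insert zero j O′) ≤ f (insert zero j O)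
    best j = maximizer n (f ∘ insert zero j) λ O O′ O≈O′ → f-cong _ _ (insert-cong O O′ O≈O′)
      where
      insert-cong : ∀ (O O′ : Ordering n) → O Perm.≈ O′ → insert zero j O Perm.≈ insert zero j O′
      insert-cong O O′ O≈O′ zero    = ≡.refl
      insert-cong O O′ O≈O′ (suc i) = ≡.cong (punchIn j) (O≈O′ i)

    candidate : Fin (ℕ.suc n) → Ordering (ℕ.suc n)
    candidate j = insert zero j (proj₁ (best j))

    j₀ : Fin (ℕ.suc n)
    j₀ = argmax (f ∘ candidate) zero (allFin (ℕ.suc n))

    bound : ∀ O → f O ≤ f (candidate j₀)
    bound O = begin
      f O                              ≈⟨ f-cong _ O (insert-remove zero O) ⟨
      f (insert zero j (remove zero O))  ≤⟨ proj₂ (best j) (remove zero O) ⟩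
      f (candidate j)                  ≤⟨ All.lookup (f[xs]≤f[argmax] {f = f ∘ candidate} zero (allFin _)) (∈-allFin j) ⟩
      f (candidate j₀)                 ∎
      where
      j : Fin (ℕ.suc n)
      j = O ⟨$⟩ʳ zero

  maximum-exists : ∀ {n} {f : Ordering n → Carrier} → (∀ O O′ → O Perm.≈ O′ → f O ≈ f O′) →
                   ∃ (IsMaximum f)
  maximum-exists {n} {f} f-cong with maximizer n f f-cong
  ... | O , max = f O , (O , refl) , max

  -- The value depends on the ordering only through `sequence`, which is equal for pointwise equal
  -- permutations.
  S₊-cong : ∀ {n} (prob : Fin n → Carrier) d (O O′ : Ordering n) → O Perm.≈ O′ → S₊ prob d O ≈ S₊ prob d O′
  S₊-cong {n} prob d O O′ O≈O′ = reflexive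
    (≡.cong (λ s → sum {ℕ.suc n} λ k →
       allAccepted prob (take (toℕ k) s) * stops prob (drop (toℕ k) s) * Div d (take (toℕ k) s))
     (tabulate-cong O≈O′))

-- Equal acceptance probabilities.

module UniformAcceptance {c ℓ₁ ℓ₂} (F : OrderedField c ℓ₁ ℓ₂) {n : ℕ}
  (prob : Fin n → OrderedField.Carrier F) (p : OrderedField.Carrier F)
  (0≤p : OrderedField._≤_ F (OrderedField.0# F) p) (p≤1 : OrderedField._≤_ F p (OrderedField.1# F))
  (prob≈p : ∀ i → OrderedField._≈_ F (prob i) p)
  where

  open OrderedField F hiding (zero)
  open SequentialDiversity F
  open OrderedFieldProperties F
  open CommutativeMonoidSum +-commutativeMonoid using (sum; ∑-distrib-+)

  allAccepted-cong : ∀ X Y → length X ≡ length Y → allAccepted prob X ≈ allAccepted prob Y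
  allAccepted-cong []      []      _     = refl
  allAccepted-cong (x ∷ X) (y ∷ Y) |X|≡|Y| =
    *-cong (trans (prob≈p x) (sym (prob≈p y))) (allAccepted-cong X Y (ℕ.suc-injective |X|≡|Y|))

  allAccepted-nonNeg : ∀ X → 0# ≤ allAccepted prob X
  allAccepted-nonNeg []      = 0≤1
  allAccepted-nonNeg (x ∷ X) = *-nonNeg (≤-respʳ-≈ (sym (prob≈p x)) 0≤p) (allAccepted-nonNeg X)

  stops-cong : ∀ X Y → length X ≡ length Y → stops prob X ≈ stops prob Y
  stops-cong []      []      _ = refl
  stops-cong (x ∷ X) (y ∷ Y) _ = +-congˡ (-‿cong (trans (prob≈p x) (sym (prob≈p y))))

  stops-nonNeg : ∀ X → 0# ≤ stops prob X
  stops-nonNeg []      = 0≤1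
  stops-nonNeg (x ∷ X) = x≤y⇒0≤y-x (≤-respˡ-≈ (sym (prob≈p x)) p≤1)

  length-sequence : ∀ (O O′ : Ordering n) → length (sequence O) ≡ length (sequence O′)
  length-sequence O O′ = ≡.trans (length-tabulate (O ⟨$⟩ʳ_)) (≡.sym (length-tabulate (O′ ⟨$⟩ʳ_)))

  length-take-sequence : ∀ (O O′ : Ordering n) k → length (take k (sequence O)) ≡ length (take k (sequence O′))
  length-take-sequence O O′ k = ≡.trans (length-take k (sequence O))
    (≡.trans (≡.cong (k ℕ.⊓_) (length-sequence O O′)) (≡.sym (length-take k (sequence O′))))

  length-drop-sequence : ∀ (O O′ : Ordering n) k → length (drop k (sequence O)) ≡ length (drop k (sequence O′))
  length-drop-sequence O O′ k = ≡.trans (length-drop k (sequence O))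
    (≡.trans (≡.cong (ℕ._∸ k) (length-sequence O O′)) (≡.sym (length-drop k (sequence O′))))

  -- Only the lengths of the prefix and of the remainder enter, and these are common to all
  -- orderings.
  prefixProbability-cong : ∀ O O′ k → prefixProbability prob O k ≈ prefixProbability prob O′ k
  prefixProbability-cong O O′ k =
    *-cong (allAccepted-cong (take k (sequence O)) (take k (sequence O′)) (length-take-sequence O O′ k))
           (stops-cong (drop k (sequence O)) (drop k (sequence O′)) (length-drop-sequence O O′ k))

  prefixProbability-nonNeg : ∀ O k → 0# ≤ prefixProbability prob O k
  prefixProbability-nonNeg O k = *-nonNeg (allAccepted-nonNeg (take k (sequence O))) (stops-nonNeg (drop k (sequence O)))

  sequence-unique : (O : Ordering n) → Unique (sequence O)
  sequence-unique O = Unique.tabulate⁺ (Func.Injection.injective (Inverse.↔⇒↣ O))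

  -- The comparison already holds term by term: at each length k, `greedy-bound` is multiplied by
  -- the common nonnegative weight.
  S₊-greedy : ∀ d → IsMetric d → (S : Ordering n) → GreedyOutput d S → ∀ O →
              S₊ prob d O ≤ S₊ prob d S + S₊ prob d S
  S₊-greedy d isMetric S greedy O = begin
    S₊ prob d O
      ≤⟨ sum-mono-≤ bound ⟩
    (sum {ℕ.suc n} λ k → term k + term k)
      ≈⟨ ∑-distrib-+ {ℕ.suc n} term term ⟩
    S₊ prob d S + S₊ prob d S
      ∎
    where
    open MetricDiversity F d isMetric
    open PartialOrderReasoning (TotalOrder.poset totalOrder)

    term : Fin (ℕ.suc n) → Carrier
    term k = prefixProbability prob S (toℕ k) * Div d (take (toℕ k) (sequence S))

    bound : ∀ i → prefixProbability prob O (toℕ i) * Div d (take (toℕ i) (sequence O)) ≤ term i + term i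
    bound i = begin
      P O * D O
        ≤⟨ *-monoˡ-≤ (P O) (prefixProbability-nonNeg O k)
             (greedy-bound (greedy-prefix k greedy) (Unique.take⁺ k (sequence-unique O)) (length-take-sequence O S k)) ⟩
      P O * (D S + D S)
        ≈⟨ *-congʳ (prefixProbability-cong O S k) ⟩
      P S * (D S + D S)
        ≈⟨ distribˡ (P S) (D S) (D S) ⟩
      P S * D S + P S * D S
        ∎
      where
      k : ℕ
      k = toℕ i
      P D : Ordering n → Carrier
      P O = prefixProbability prob O k
      D O = Div d (take k (sequence O))

-- The approximation guarantee for MaxSSD.

theorem8p1 : ∀ {c ℓ₁ ℓ₂} (F : OrderedField c ℓ₁ ℓ₂) →
    let open OrderedField F
        open SequentialDiversity F in
    (n : ℕ) (d : Fin n → Fin n → Carrier) → IsMetric d →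
    (prob : Fin n → Carrier) (p : Carrier) → 0# ≤ p → p ≤ 1# →
    (∀ i → prob i ≈ p) →
    (S : Ordering n) → GreedyOutput d S →
    ∃ λ opt → IsMaximum (S₊ prob d) opt × ½ * opt ≤ S₊ prob d S
theorem8p1 F n d isMetric prob p 0≤p p≤1 prob≈p S greedy
  with OptimalOrdering.maximum-exists F (OptimalOrdering.S₊-cong F prob d)
-- The factor two bound is applied to the ordering `O` at which the maximum is attained.
... | opt , (O , SO≈opt) , max = opt , ((O , SO≈opt) , max) , x≤y+y⇒½x≤y
  (≤-respˡ-≈ SO≈opt (UniformAcceptance.S₊-greedy F prob p 0≤p p≤1 prob≈p d isMetric S greedy O))
  where
  open OrderedField F
  open OrderedFieldProperties F
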